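{- Let $G$ and $G+x$ be connected graphs, and let $ST(G)=(T,\mathcal F)$ be marked with respect to the set $N(x)$ of leaves. (case 5) If $ST(G)$ contains a unique tree-edge $e$ both of whose extremities are perfect, then $ST(G+x)$ is obtained by subdividing $e$ with a new clique node adjacent to the leaf $x$ and to $e$'s extremities. (case 6) If $ST(G)$ contains a unique tree-edge $e$ one of whose extremities is perfect and the other empty, then $ST(G+x)$ is obtained by subdividing $e$ with a new star node adjacent to the leaf $x$ and to $e$'s extremities, such that the centre of the star is opposite $e$'s empty extremity.
   Context: Graphs are finite, simple and undirected. $G+x$ is obtained from $G$ by adding a new vertex $x$ with neighbourhood $N(x)\subseteq V(G)$. For a vertex set $S$, $N(S)=(\bigcup_{y\in S}N(y))\setminus S$. Splits. A split of a connected graph is a bipartition $(A,B)$ of its vertex set with $|A|,|B|>1$ such that every vertex of $N(B)$ is adjacent to every vertex of $N(A)$. A star is a graph with at least three vertices having one vertex (its centre) adjacent to all others and no other edges. Cliques (complete graphs) and stars are degenerate; a graph with no split that is not degenerate is prime. Graph-labelled trees. A graph-labelled tree (GLT) $(T,\mathcal F)$ is a tree $T$ whose non-leaf vertices are called nodes (each of degree at least 3), where each node $u$ is labelled by a graph $G(u)\in\mathcal F$ together with a bijection $\rho_u$ from the tree-edges incident to $u$ to $V(u):=V(G(u))$. A node is called clique, star, prime, degenerate according to its label. Vertices of labels are marker vertices; edges of labels are label-edges. The extremities of a tree-edge $e$ are: at an end that is a node $u$, the marker vertex $\rho_u(e)$; at an end that is a leaf, the leaf itself. The two extremities of a tree-edge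 are opposite to each other. Two elements (leaves or marker vertices) are accessible from one another if there is a sequence of leaves and marker vertices joining them whose consecutive elements are either the two extremities of a tree-edge or the two vertices of a label-edge, with tree-edges and label-edges alternating. The accessibility graph of the GLT has the leaves of $T$ as vertices, distinct leaves being adjacent iff accessible from one another. (The GLT of $K_2$ is one edge between two leaves.) Node-joins. For a tree-edge between nodes $u,u'$ with extremities $q\in V(u)$, $q'\in V(u')$, the node-join replaces $u,u'$ by one node labelled by the graph obtained from $G(u)$ and $G(u')$ by adding all edges between $N(q)$ and $N(q')$ and deleting $q,q'$. It is a clique-join if both labels are cliques, and a star-join if both are stars and exactly one of $q,q'$ is the centre of its star. A GLT is reduced if all its labels are prime or degenerate and no clique-join or star-join is possible. Every connected graph $G$ is the accessibility graph of a unique reduced GLT, the split-tree $ST(G)$. Subdividing a tree-edge $e$ with a new node adjacent to $x$ means replacing $e$ by a path through a new node $w$ of degree three with a new leaf $x$ attached to $w$; the extremities of $e$ become opposites of two of the three marker vertices of $w$, and $x$ is the opposite of the third. States. For a marker vertex $q\in V(u)$ corresponding to the tree-edge $e$, $L(q)$ is the set of leaves in the component of $T-e$ not containing $u$, and $A(q)$ is the set of leaves of $L(q)$ accessible from $q$. For a leaf $\ell$, $L(\ell)$ is the set of all other leaves and $A(\ell)=N_G(\ell)$. With respect to a set $S$ of leaves (here $S=N(x)$), a leaf or marker vertex $q$ is perfect if $S\cap L(q)=A(q)$, empty if $S\cap L(q)=\emptyset$, and mixed otherwise. Tree-edges incident to leaves are included, a leaf being an extremity of its incident edge. -}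

module Defs where

open import Data.Empty using (⊥)
open import Data.Fin using (Fin; zero; suc)
import Data.Fin as Fin
open import Data.Fin.Subset using (Subset; _∈_; _∉_; ∁; ∣_∣)
open import Data.Fin.Subset.Properties using (_∈?_)
open import Data.List using (List; []; _∷_; map)
open import Data.List.Relation.Unary.All using (All)
open import Data.List.Relation.Unary.AllPairs using (AllPairs)
open import Data.List.Relation.Unary.Unique.Propositional using (Unique)
open import Data.Nat using (ℕ; suc; _≤_; _<_)
open import Data.Product using (∃; ∃-syntax; _×_; _,_)
open import Data.Sum using (_⊎_; inj₁; inj₂)
import Data.Sum as Sum
open import Function using (_∘_)
open import Function.Bundles using (_⇔_)
open import Level using (0ℓ)
open import Relation.Binary.Core using (Rel)
open import Relation.Binary.Definitions
  using (Decidable; DecidableEquality; Irreflexive; Symmetric)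
open import Relation.Binary.Construct.Closure.ReflexiveTransitive using (Star)
open import Relation.Binary.PropositionalEquality using (_≡_; _≢_; refl; sym)
open import Relation.Nullary using (¬_; yes; no)
open import Relation.Nullary.Decidable using (¬?; _×-dec_; _⊎-dec_)
open import Relation.Unary using (Pred; _∩_; _≐_; Empty)

record Graph (n : ℕ) : Set₁ where
  field
    Adj        : Rel (Fin n) 0ℓ
    adj?       : Decidable Adj
    adj-sym    : Symmetric Adj
    adj-irrefl : Irreflexive _≡_ Adj

open Graph public

Connected : ∀ {n} → Graph n → Set
Connected G = ∀ i j → Star (Adj G) i j

-- G + x with N(x) = S: the new vertex x is zero, the old vertex i is suc i.
addVertex : ∀ {n} → Graph n → Subset n → Graph (suc n)
addVertex {n} G S = record
  { Adj        = E
  ; adj?       = E?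
  ; adj-sym    = λ {i} {j} → E-sym i j
  ; adj-irrefl = λ { {i} refl → E-irrefl i }
  }
  where
  E : Rel (Fin (suc n)) 0ℓ
  E zero    zero    = ⊥
  E zero    (suc j) = j ∈ S
  E (suc i) zero    = i ∈ S
  E (suc i) (suc j) = Adj G i j

  E? : Decidable E
  E? zero    zero    = no λ ()
  E? zero    (suc j) = j ∈? S
  E? (suc i) zero    = i ∈? S
  E? (suc i) (suc j) = adj? G i j

  E-sym : ∀ i j → E i j → E j i
  E-sym zero    (suc j) p = p
  E-sym (suc i) zero    p = p
  E-sym (suc i) (suc j) p = adj-sym G p

  E-irrefl : ∀ i → ¬ E i i
  E-irrefl (suc i) p = adj-irrefl G refl p

complete : ∀ n → Graph n
complete n = record
  { Adj        = _≢_
  ; adj?       = λ i j → ¬? (i Fin.≟ j)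
  ; adj-sym    = λ i≢j → i≢j ∘ sym
  ; adj-irrefl = λ i≡j i≢j → i≢j i≡j
  }

star : ∀ {n} → Fin n → Graph n
star c = record
  { Adj        = λ i j → (i ≡ c × j ≢ c) ⊎ (j ≡ c × i ≢ c)
  ; adj?       = λ i j → ((i Fin.≟ c) ×-dec ¬? (j Fin.≟ c))
                   ⊎-dec ((j Fin.≟ c) ×-dec ¬? (i Fin.≟ c))
  ; adj-sym    = Sum.swap
  ; adj-irrefl = λ { refl (inj₁ (p , ¬p)) → ¬p p ; refl (inj₂ (p , ¬p)) → ¬p p }
  }

module _ {n} (G : Graph n) where

  N : Subset n → Pred (Fin n) 0ℓ
  N S v = v ∉ S × (∃[ y ] y ∈ S × Adj G y v)

  -- The bipartition is (A , ∁ A).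
  IsSplit : Subset n → Set
  IsSplit A = 1 < ∣ A ∣ × 1 < ∣ ∁ A ∣
            × (∀ {i j} → N (∁ A) i → N A j → Adj G i j)

  IsClique : Set
  IsClique = ∀ {i j} → i ≢ j → Adj G i j

  IsStarCentre : Fin n → Set
  IsStarCentre c = 3 ≤ n
                 × (∀ {i} → i ≢ c → Adj G c i)
                 × (∀ {i j} → Adj G i j → i ≡ c ⊎ j ≡ c)

  IsStar : Set
  IsStar = ∃ IsStarCentre

  IsDegenerate : Set
  IsDegenerate = IsClique ⊎ IsStar

  -- Splits are a notion about connected graphs, so prime graphs are connected.
  IsPrime : Set
  IsPrime = Connected G × (∀ A → ¬ IsSplit A) × ¬ IsDegenerate

data Extremity (n : ℕ) {k : ℕ} (degree : Fin k → ℕ) : Set where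
  leaf   : Fin n → Extremity n degree
  marker : (u : Fin k) → Fin (degree u) → Extremity n degree

data TreeVertex (n k : ℕ) : Set where
  leaf : Fin n → TreeVertex n k
  node : Fin k → TreeVertex n k

infix 4 _≟_
_≟_ : ∀ {n k} {degree : Fin k → ℕ} → DecidableEquality (Extremity n degree)
leaf i ≟ leaf j with i Fin.≟ j
... | yes refl = yes refl
... | no i≢j   = no λ { refl → i≢j refl }
leaf _     ≟ marker _ _ = no λ ()
marker _ _ ≟ leaf _     = no λ ()
marker u i ≟ marker v j with u Fin.≟ v
... | no u≢v = no λ { refl → u≢v refl }
... | yes refl with i Fin.≟ j
...   | yes refl = yes refl
...   | no i≢j   = no λ { refl → i≢j refl }

-- The data of a graph-labelled tree with leaf set Fin n.  The tree is given
-- by its tree-edges: these are the pairs {q , opposite q}, so that a tree-edge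
-- is referred to by either of its extremities.  The bijection ρᵤ sends a
-- tree-edge incident to the node u to its extremity of the form marker u i;
-- in particular the degree of u in the tree is the order of its label.
record RawGLT (n : ℕ) : Set₁ where
  field
    nodes    : ℕ
    degree   : Fin nodes → ℕ
    label    : ∀ u → Graph (degree u)
    opposite : Extremity n degree → Extremity n degree

  -- The end of the tree-edge {q , opposite q} at which q lies.
  end : Extremity n degree → TreeVertex n nodes
  end (leaf ℓ)     = leaf ℓ
  end (marker u _) = node u

module _ {n} (T : RawGLT n) where
  open RawGLT T

  SameEdge : Rel (Extremity n degree) 0ℓ
  SameEdge q r = r ≡ q ⊎ r ≡ opposite q

  -- A walk in the tree is recorded by the list of its tree-edges, each one
  -- represented by the extremity at the end from which it is traversed.
  IsWalk : TreeVertex n nodes → TreeVertex n nodes →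
           List (Extremity n degree) → Set
  IsWalk v w []       = v ≡ w
  IsWalk v w (q ∷ qs) = end q ≡ v × IsWalk (end (opposite q)) w qs

  TreeConnected : Set
  TreeConnected = ∀ v w → ∃ (IsWalk v w)

  -- A closed walk with no repeated vertex and no repeated tree-edge; loops
  -- and pairs of parallel tree-edges are cycles of length one and two.
  IsCycle : List (Extremity n degree) → Set
  IsCycle qs = qs ≢ [] × (∃[ v ] IsWalk v v qs)
             × Unique (map end qs)
             × AllPairs (λ q r → ¬ SameEdge q r) qs

  IsTree : Set
  IsTree = TreeConnected × (∀ qs → ¬ IsCycle qs)

  record IsGLT : Set where
    field
      opposite-involutive : ∀ q → opposite (opposite q) ≡ q
      opposite-distinct   : ∀ q → opposite q ≢ q
      degree≥3            : ∀ u → 3 ≤ degree u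
      isTree              : IsTree

  data Step : Set where
    tree-edge label-edge : Step

  -- Alternating sequences; the first index is the kind of the next step.
  data Alternating : Step → Extremity n degree → Extremity n degree → Set where
    []       : ∀ {s q} → Alternating s q q
    viaTree  : ∀ {q r} → Alternating label-edge (opposite q) r →
               Alternating tree-edge q r
    viaLabel : ∀ {u i j r} → Adj (label u) i j →
               Alternating tree-edge (marker u j) r →
               Alternating label-edge (marker u i) r

  Accessible : Rel (Extremity n degree) 0ℓ
  Accessible q r = ∃[ s ] Alternating s q r

  IsAccessibilityGraph : Graph n → Set
  IsAccessibilityGraph G =
    ∀ i j → Adj G i j ⇔ (i ≢ j × Accessible (leaf i) (leaf j))

  CliqueJoinPossible : Set
  CliqueJoinPossible = ∃[ u ] ∃[ i ] ∃[ v ] ∃[ j ]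
    opposite (marker u i) ≡ marker v j × IsClique (label u) × IsClique (label v)

  StarJoinPossible : Set
  StarJoinPossible = ∃[ u ] ∃[ i ] ∃[ v ] ∃[ j ]
    opposite (marker u i) ≡ marker v j × IsStar (label u) × IsStar (label v)
    × ((IsStarCentre (label u) i × ¬ IsStarCentre (label v) j)
      ⊎ (¬ IsStarCentre (label u) i × IsStarCentre (label v) j))

  IsReduced : Set
  IsReduced = (∀ u → IsPrime (label u) ⊎ IsDegenerate (label u))
            × ¬ CliqueJoinPossible × ¬ StarJoinPossible

  IsSplitTree : Graph n → Set
  IsSplitTree G = IsGLT × IsReduced × IsAccessibilityGraph G

module _ {n} (T : RawGLT n) where
  open RawGLT T

  -- For a marker vertex q ∈ V(u) with tree-edge e, the component of T - e not
  -- containing u is the one containing the other end of e.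
  L : Extremity n degree → Pred (Fin n) 0ℓ
  L (leaf i)       ℓ = ℓ ≢ i
  L q@(marker _ _) ℓ = ∃[ qs ] IsWalk T (end (opposite q)) (leaf ℓ) qs
                             × All (λ r → ¬ SameEdge T q r) qs

  module _ (G : Graph n) where

    A : Extremity n degree → Pred (Fin n) 0ℓ
    A (leaf i)       ℓ = Adj G i ℓ
    A q@(marker _ _) ℓ = L q ℓ × Accessible T q (leaf ℓ)

    Perfect : Subset n → Pred (Extremity n degree) 0ℓ
    Perfect S q = ((_∈ S) ∩ L q) ≐ A q

  EmptyState : Subset n → Pred (Extremity n degree) 0ℓ
  EmptyState S q = Empty ((_∈ S) ∩ L q)

  UniqueEdge : Pred (Extremity n degree) 0ℓ → Pred (Extremity n degree) 0ℓ
  UniqueEdge P q = P q × (∀ r → P r → SameEdge T q r)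

markerˣ marker₁ marker₂ : Fin 3
markerˣ = zero
marker₁ = suc zero
marker₂ = suc (suc zero)

-- The tree-edge {q , opposite q} is subdivided with a new node (numbered zero)
-- labelled by H and adjacent to the new leaf x (numbered zero).  Of its marker
-- vertices, markerˣ is opposite x, marker₁ is opposite q and marker₂ is
-- opposite the former opposite of q.
module _ {n} (T : RawGLT n) (q : Extremity n (RawGLT.degree T)) (H : Graph 3) where
  open RawGLT T

  degree⁺ : Fin (suc nodes) → ℕ
  degree⁺ zero    = 3
  degree⁺ (suc u) = degree u

  label⁺ : ∀ u → Graph (degree⁺ u)
  label⁺ zero    = H
  label⁺ (suc u) = label u

  old : Extremity n degree → Extremity (suc n) degree⁺
  old (leaf ℓ)     = leaf (suc ℓ)
  old (marker u i) = marker (suc u) i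

  opposite-old : Extremity n degree → Extremity (suc n) degree⁺
  opposite-old r with r ≟ q | r ≟ opposite q
  ... | yes _ | _     = marker zero marker₁
  ... | no  _ | yes _ = marker zero marker₂
  ... | no  _ | no  _ = old (opposite r)

  opposite⁺ : Extremity (suc n) degree⁺ → Extremity (suc n) degree⁺
  opposite⁺ (leaf zero)                    = marker zero markerˣ
  opposite⁺ (leaf (suc ℓ))                 = opposite-old (leaf ℓ)
  opposite⁺ (marker zero zero)             = leaf zero
  opposite⁺ (marker zero (suc zero))       = old q
  opposite⁺ (marker zero (suc (suc zero))) = old (opposite q)
  opposite⁺ (marker (suc u) i)             = opposite-old (marker u i)

  subdivide : RawGLT (suc n)
  subdivide = record
    { nodes    = suc nodes
    ; degree   = degree⁺
    ; label    = label⁺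
    ; opposite = opposite⁺
    }

-- In a tree every nonempty closed walk backtracks, so the leaves beyond opposite (marker u i) are the
-- disjoint union of those beyond the other marker vertices j of u, and such a leaf is accessible
-- through u iff it is accessible from some j adjacent to i.  Hence states propagate across u.  If
-- the new node could be joined with a neighbour u, then u would be a clique, or a star with the
-- appropriate centre, and propagation across u would produce a second tree-edge with the states
-- of e, against uniqueness.  Accessibility between old leaves is unaffected, as marker₁ and
-- marker₂ are adjacent, and x reaches A q and A (opposite q), or A q only, which is S by the
-- states of e.  The subdivision is acyclic because contracting the path from x through the new
-- node to the end of q maps closed trails to closed trails of the original tree.
module Submission where

open import Defs
open import Data.Empty using (⊥; ⊥-elim)
open import Data.Fin using (Fin; zero; suc)
import Data.Fin as Fin
open import Data.Fin.Properties using (suc-injective)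
open import Data.Fin.Subset using (Subset; _∈_; _∉_)
open import Data.List using (List; []; _∷_; _++_)
open import Data.List.Relation.Unary.All using (All; []; _∷_)
import Data.List.Relation.Unary.All as All
open import Data.List.Relation.Unary.All.Properties using (++⁺; ++⁻ˡ)
open import Data.List.Relation.Unary.AllPairs using (AllPairs; []; _∷_)
import Data.List.Relation.Unary.AllPairs as AllPairs
import Data.List.Relation.Unary.AllPairs.Properties as AllPairsₚ
open import Data.List.Relation.Unary.Linked using (Linked; []; [-]; _∷_)
import Data.List.Relation.Unary.Linked as Linked
open import Data.List.Relation.Unary.Linked.Properties using (AllPairs⇒Linked)
open import Data.Nat using (ℕ; suc; z≤n; s≤s; _≤_)
open import Data.Product using (∃; ∃-syntax; _×_; _,_; proj₁; proj₂)
open import Data.Sum using (_⊎_; inj₁; inj₂; [_,_]′)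
open import Function using (_∘_; _on_)
open import Function.Bundles using (_⇔_; mk⇔; Equivalence)
open import Level using (0ℓ)
open import Relation.Binary.Core using (Rel)
open import Relation.Binary.Definitions using (DecidableEquality)
open import Relation.Binary.PropositionalEquality
open import Relation.Nullary using (¬_; yes; no)
open import Relation.Unary using (Pred)

open Equivalence using (to; from)

-- Prefixes of lists and equality of tree vertices.

Linked-++⁻ˡ : ∀ {A : Set} {R : Rel A 0ℓ} xs {ys} → Linked R (xs ++ ys) → Linked R xs
Linked-++⁻ˡ []           _         = []
Linked-++⁻ˡ (x ∷ [])     _         = [-]
Linked-++⁻ˡ (x ∷ y ∷ xs) (Rxy ∷ l) = Rxy ∷ Linked-++⁻ˡ (y ∷ xs) l

AllPairs-++⁻ˡ : ∀ {A : Set} {R : Rel A 0ℓ} xs {ys} → AllPairs R (xs ++ ys) → AllPairs R xs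
AllPairs-++⁻ˡ []       _        = []
AllPairs-++⁻ˡ (x ∷ xs) (p ∷ ps) = ++⁻ˡ xs p ∷ AllPairs-++⁻ˡ xs ps

infix 4 _≟ᵛ_
_≟ᵛ_ : ∀ {n k} → DecidableEquality (TreeVertex n k)
leaf i ≟ᵛ leaf j with i Fin.≟ j
... | yes refl = yes refl
... | no i≢j   = no λ { refl → i≢j refl }
leaf _ ≟ᵛ node _ = no λ ()
node _ ≟ᵛ leaf _ = no λ ()
node u ≟ᵛ node v with u Fin.≟ v
... | yes refl = yes refl
... | no u≢v   = no λ { refl → u≢v refl }

-- Walks without backtracking.

module Walks {n} (T : RawGLT n) where
  open RawGLT T

  walk-++ : ∀ as {bs u v w} → IsWalk T u v as → IsWalk T v w bs → IsWalk T u w (as ++ bs)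
  walk-++ []       refl     W′ = W′
  walk-++ (a ∷ as) (eq , W) W′ = eq , walk-++ as W W′

  Reduced : Pred (List (Extremity n degree)) 0ℓ
  Reduced = Linked (λ q r → r ≢ opposite q)

  -- Cuts closed walks down to cycles. The extremities of `rs` only show where its steps start, so
  -- the last vertex `w` has a clause of its own.
  firstVisit : ∀ rs {v w} → IsWalk T v w rs → ∀ t →
    (All (λ r → t ≢ end r) rs × w ≢ t)
    ⊎ (∃[ as ] ∃[ bs ] rs ≡ as ++ bs × IsWalk T v t as × All (λ r → t ≢ end r) as)
  firstVisit [] {v} refl t with v ≟ᵛ t
  ... | yes refl = inj₂ ([] , [] , refl , refl , [])
  ... | no v≢t   = inj₁ ([] , v≢t)
  firstVisit (r ∷ rs) (refl , W) t with t ≟ᵛ end r | firstVisit rs W t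
  ... | yes refl | _ = inj₂ ([] , r ∷ rs , refl , refl , [])
  ... | no t≢r   | inj₁ (all , w≢t) = inj₁ (t≢r ∷ all , w≢t)
  ... | no t≢r   | inj₂ (as , bs , refl , V , all) =
    inj₂ (r ∷ as , bs , refl , (refl , V) , t≢r ∷ all)

  -- A later step equal to `opposite q` starts where `q` arrives, which is also where the successor
  -- of `q` starts. Distinct ends make it that successor, and then the walk backtracks.
  distinctEnds⇒distinctEdges : ∀ qs {v w} → IsWalk T v w qs → Reduced qs →
    AllPairs (_≢_ on end) qs → AllPairs (λ q r → ¬ SameEdge T q r) qs
  distinctEnds⇒distinctEdges []       _        _   _          = []
  distinctEnds⇒distinctEdges (q ∷ qs) (_ , W) red (≢q ∷ ≢s) =
    heads qs W red ≢q ≢s ∷ distinctEnds⇒distinctEdges qs W (Linked.tail red) ≢s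
    where
    heads : ∀ rs {w} → IsWalk T (end (opposite q)) w rs → Reduced (q ∷ rs) →
      All (λ r → end q ≢ end r) rs → AllPairs (_≢_ on end) rs →
      All (λ r → ¬ SameEdge T q r) rs
    heads []       _        _          _          _          = []
    heads (a ∷ rs) (eq , _) (a≢q̄ ∷ _) (q≢a ∷ q≢) (a≢ ∷ _) =
      (λ { (inj₁ refl) → q≢a refl ; (inj₂ a≡q̄) → a≢q̄ a≡q̄ })
      ∷ All.zipWith (λ { (q≢r , _)   (inj₁ refl) → q≢r refl
                       ; (_   , a≢r) (inj₂ refl) → a≢r eq }) (q≢ , a≢)

-- Walks in a tree.

module Tree {n} {T : RawGLT n} (glt : IsGLT T) where
  open RawGLT T
  open IsGLT glt
  open Walks T public

  -- By induction the tail has distinct ends, so a first return to `end q` would cut out a closed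
  -- walk with distinct ends, hence with distinct tree-edges: a cycle.
  reduced⇒distinctEnds : ∀ qs {v w} → IsWalk T v w qs → Reduced qs →
    AllPairs (_≢_ on end) qs
  reduced⇒distinctEnds []       _        _   = []
  reduced⇒distinctEnds (q ∷ rs) (_ , W) red
    with reduced⇒distinctEnds rs W (Linked.tail red) | firstVisit rs W (end q)
  ... | ≢s | inj₁ (q≢ , _) = q≢ ∷ ≢s
  ... | ≢s | inj₂ (as , bs , refl , V , q≢) = ⊥-elim (proj₂ isTree (q ∷ as) cycle)
    where
    distinct : AllPairs (_≢_ on end) (q ∷ as)
    distinct = q≢ ∷ AllPairs-++⁻ˡ as ≢s

    cycle : IsCycle T (q ∷ as)
    cycle = (λ ()) , (end q , refl , V) , AllPairsₚ.map⁺ distinct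
          , distinctEnds⇒distinctEdges (q ∷ as) (refl , V) (Linked-++⁻ˡ (q ∷ as) red) distinct

  reduced⇒distinctEdges : ∀ qs {v w} → IsWalk T v w qs → Reduced qs →
    AllPairs (λ q r → ¬ SameEdge T q r) qs
  reduced⇒distinctEdges qs W red =
    distinctEnds⇒distinctEdges qs W red (reduced⇒distinctEnds qs W red)

  -- A closed walk revisits its first vertex at the latest when it stops. The part before the first
  -- return is a cycle.
  reduced⇒notClosed : ∀ q rs {v} → IsWalk T v v (q ∷ rs) → ¬ Reduced (q ∷ rs)
  reduced⇒notClosed q rs (refl , W) red with firstVisit rs W (end q)
  ... | inj₁ (_ , q≢q) = q≢q refl
  ... | inj₂ (as , bs , refl , V , q≢) =
    proj₂ isTree (q ∷ as)
      ( (λ ()) , (end q , refl , V)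
      , AllPairsₚ.map⁺ (AllPairs-++⁻ˡ (q ∷ as) (reduced⇒distinctEnds _ (refl , W) red))
      , AllPairs-++⁻ˡ (q ∷ as) (reduced⇒distinctEdges _ (refl , W) red))

  -- Backtracking pairs are cancelled from the right. What remains is a sublist, so any property `P`
  -- of the steps survives; the main instance is avoiding a given tree-edge.
  reduce : ∀ qs {v w} {P : Pred (Extremity n degree) 0ℓ} → IsWalk T v w qs → All P qs →
    ∃[ rs ] IsWalk T v w rs × All P rs × Reduced rs
  reduce []       W        _        = [] , W , [] , []
  reduce (q ∷ qs) (eq , W) (p ∷ ps) with reduce qs W ps
  ... | [] , V , _ , _ = q ∷ [] , (eq , V) , p ∷ [] , [-]
  ... | r ∷ rs , (eq′ , V) , pr ∷ prs , red with r ≟ opposite q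
  ...   | no r≢q̄  = q ∷ r ∷ rs , (eq , eq′ , V) , p ∷ pr ∷ prs , r≢q̄ ∷ red
  ...   | yes refl =
    rs , subst (λ u → IsWalk T u _ rs) (trans (cong end (opposite-involutive q)) eq) V
       , prs , Linked.tail red

  SameEdge-oppositeˡ : ∀ {q r} → SameEdge T q r → SameEdge T (opposite q) r
  SameEdge-oppositeˡ (inj₁ refl) = inj₂ (sym (opposite-involutive _))
  SameEdge-oppositeˡ (inj₂ refl) = inj₁ refl

  SameEdge-oppositeʳ : ∀ {q r} → SameEdge T q (opposite r) → SameEdge T q r
  SameEdge-oppositeʳ {r = r} (inj₁ refl) = inj₂ (sym (opposite-involutive r))
  SameEdge-oppositeʳ {q} {r} (inj₂ eq)   = inj₁
    (trans (sym (opposite-involutive r)) (trans (cong opposite eq) (opposite-involutive q)))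

  reverseWalk : ∀ qs {v w e} → IsWalk T v w qs → All (λ r → ¬ SameEdge T e r) qs →
    ∃[ rs ] IsWalk T w v rs × All (λ r → ¬ SameEdge T e r) rs
  reverseWalk []       refl       _        = [] , refl , []
  reverseWalk (q ∷ qs) (refl , W) (p ∷ ps) with reverseWalk qs W ps
  ... | rs , V , prs =
    rs ++ opposite q ∷ []
    , walk-++ rs V (refl , cong end (opposite-involutive q))
    , ++⁺ prs (p ∘ SameEdge-oppositeʳ ∷ [])

  avoiding⇒reduced : ∀ {q} rs → All (λ r → ¬ SameEdge T q r) rs → Reduced rs → Reduced (q ∷ rs)
  avoiding⇒reduced []       _       _   = [-]
  avoiding⇒reduced (r ∷ rs) (p ∷ _) red = (λ eq → p (inj₂ eq)) ∷ red

  loopless : ∀ {u i j} → opposite (marker u i) ≢ marker u j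
  loopless {u} {i} eq = reduced⇒notClosed (marker u i) [] (refl , cong end eq) [-]

  marker-injective : ∀ {u} {i j : Fin (degree u)} →
    _≡_ {A = Extremity n degree} (marker u i) (marker u j) → i ≡ j
  marker-injective refl = refl

  distinct-markers : ∀ {u} {i j : Fin (degree u)} → i ≢ j →
    ¬ SameEdge T (marker u i) (marker u j)
  distinct-markers i≢j (inj₁ eq) = i≢j (sym (marker-injective eq))
  distinct-markers i≢j (inj₂ eq) = loopless (sym eq)

  -- The leaves on either side of a tree-edge.

  -- L q, with the leaf and the marker case made uniform: a leaf lies beyond q iff a walk without
  -- backtracking leads to it that starts with the edge of q, traversed away from q.
  Beyond : Extremity n degree → Pred (Fin n) 0ℓ
  Beyond q ℓ = ∃[ qs ] IsWalk T (end (opposite q)) (leaf ℓ) qs × Reduced (q ∷ qs)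

  Beyond-avoiding : ∀ {q ℓ} → Beyond q ℓ →
    ∃[ qs ] IsWalk T (end (opposite q)) (leaf ℓ) qs × All (λ r → ¬ SameEdge T q r) qs
  Beyond-avoiding {q} (qs , W , red) =
    qs , W , AllPairs.head (reduced⇒distinctEdges (q ∷ qs) (refl , W) red)

  -- Going to `ℓ` on one side and back on the other never uses the edge of `q`. After reduction, `q`
  -- closes this walk up without creating a backtrack.
  Beyond-disjoint : ∀ {q ℓ} → Beyond q ℓ → ¬ Beyond (opposite q) ℓ
  Beyond-disjoint {q} b b̄ with Beyond-avoiding b | Beyond-avoiding b̄
  ... | as , V , av | bs , W , av′ with reverseWalk bs W av′
  ...   | cs , W⁻¹ , av″
    with reduce (as ++ cs) (walk-++ as V W⁻¹) (++⁺ av (All.map (_∘ SameEdge-oppositeˡ) av″))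
  ...     | rs , U , avr , red =
    reduced⇒notClosed q rs
      (refl , subst (λ x → IsWalk T (end (opposite q)) (end x) rs) (opposite-involutive q) U)
      (avoiding⇒reduced rs avr red)

  -- A reduced walk from `end q` to `ℓ` either starts with `q`, or can be prefixed by `opposite q`
  -- without backtracking.
  Beyond-cover : ∀ q ℓ → Beyond q ℓ ⊎ Beyond (opposite q) ℓ
  Beyond-cover q ℓ with proj₁ isTree (end q) (leaf ℓ)
  -- Nothing has to be carried through the reduction here, so the predicate is trivially true.
  ... | qs , W with reduce qs {P = λ _ → end q ≡ end q} W (All.universal (λ _ → refl) qs)
  ...   | [] , V , _ , _ = inj₂ ([] , trans (cong end (opposite-involutive q)) V , [-])
  ...   | r ∷ rs , (eq , V) , _ , red with r ≟ q
  ...     | yes refl = inj₁ (rs , V , red)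
  ...     | no r≢q   = inj₂
    ( r ∷ rs , (trans eq (sym (cong end (opposite-involutive q))) , V)
    , (λ eq′ → r≢q (trans eq′ (opposite-involutive q))) ∷ red)

  Beyond-leaf : ∀ {i} → Beyond (opposite (leaf i)) i
  Beyond-leaf {i} = [] , cong end (opposite-involutive (leaf i)) , [-]

  -- A leaf has a single tree-edge, so a walk that has arrived at it can only stop or backtrack. For
  -- a marker vertex, a walk avoiding the edge is reduced and then prefixed by `q`.
  L⇔Beyond : ∀ q {ℓ} → L T q ℓ ⇔ Beyond q ℓ
  L⇔Beyond (leaf i) {ℓ} = mk⇔ there back
    where
    there : ℓ ≢ i → Beyond (leaf i) ℓ
    there ℓ≢i with Beyond-cover (leaf i) ℓ
    ... | inj₁ b = b
    ... | inj₂ ([] , eq , _) with trans (sym (cong end (opposite-involutive (leaf i)))) eq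
    ...   | refl = ⊥-elim (ℓ≢i refl)
    there ℓ≢i | inj₂ (r ∷ rs , (eq , V) , r≢ ∷ red)
      with r | trans eq (cong end (opposite-involutive (leaf i)))
    ...   | leaf _ | refl = ⊥-elim (r≢ (sym (opposite-involutive (leaf i))))

    back : Beyond (leaf i) ℓ → ℓ ≢ i
    back b refl = Beyond-disjoint b Beyond-leaf
  L⇔Beyond q@(marker _ _) = mk⇔ there Beyond-avoiding
    where
    there : ∀ {ℓ} → L T q ℓ → Beyond q ℓ
    there (qs , W , av) with reduce qs W av
    ... | rs , V , av′ , red = rs , V , avoiding⇒reduced rs av′ red

  Beyond-across : ∀ {u i j ℓ} → i ≢ j → Beyond (marker u j) ℓ → Beyond (opposite (marker u i)) ℓ
  Beyond-across {u} {i} {j} i≢j (qs , W , red) =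
    marker u j ∷ qs , (sym (cong end (opposite-involutive (marker u i))) , W)
    , (λ eq → i≢j (sym (marker-injective (trans eq (opposite-involutive (marker u i)))))) ∷ red

  -- The walk has arrived at the node `u`, where it cannot stop, and it must leave through a marker
  -- vertex other than `i`.
  Beyond-branch : ∀ {u i ℓ} → Beyond (opposite (marker u i)) ℓ →
    ∃[ j ] i ≢ j × Beyond (marker u j) ℓ
  Beyond-branch {u} {i} ([] , eq , _) with trans (sym (cong end (opposite-involutive (marker u i)))) eq
  ... | ()
  Beyond-branch {u} {i} (r ∷ rs , (eq , V) , r≢ ∷ red)
    with r | trans eq (cong end (opposite-involutive (marker u i)))
  ... | marker _ j | refl =
    j , (λ { refl → r≢ (sym (opposite-involutive (marker u i))) }) , rs , V , red

  Beyond-unique : ∀ {u i j ℓ} → Beyond (marker u i) ℓ → Beyond (marker u j) ℓ → i ≡ j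
  Beyond-unique {i = i} {j} bᵢ bⱼ with i Fin.≟ j
  ... | yes eq = eq
  ... | no i≢j = ⊥-elim (Beyond-disjoint bᵢ (Beyond-across i≢j bⱼ))

  -- A q in the same uniform shape: the tree-edge from q has already been traversed.
  Reaches : Extremity n degree → Pred (Fin n) 0ℓ
  Reaches q ℓ = Alternating T label-edge (opposite q) (leaf ℓ)

  Reaches-across : ∀ {u i j ℓ} → Adj (label u) i j → Reaches (marker u j) ℓ →
    Reaches (opposite (marker u i)) ℓ
  Reaches-across {u} {i} {j} ij p =
    subst (λ q → Alternating T label-edge q _) (sym (opposite-involutive (marker u i)))
      (viaLabel ij (viaTree p))

  Reaches-branch : ∀ {u i ℓ} → Reaches (opposite (marker u i)) ℓ →
    ∃[ j ] Adj (label u) i j × Reaches (marker u j) ℓ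
  Reaches-branch {u} {i} p
    with subst (λ q → Alternating T label-edge q _) (opposite-involutive (marker u i)) p
  ... | viaLabel ij (viaTree p′) = _ , ij , p′

  -- A label-edge joins two different marker vertices, so the tree-edges of an alternating sequence
  -- form a walk without backtracking.
  Reaches⇒Beyond : ∀ {q ℓ} → Reaches q ℓ → Beyond q ℓ
  Reaches⇒Beyond p = along p refl
    where
    along : ∀ {q r ℓ} → Alternating T label-edge r (leaf ℓ) → opposite q ≡ r → Beyond q ℓ
    along [] eq = [] , cong end eq , [-]
    along {q} (viaLabel {u} {i} {j} ij (viaTree p)) eq =
      subst (λ r → Beyond r _) (trans (cong opposite (sym eq)) (opposite-involutive q))
        (Beyond-across (λ i≡j → adj-irrefl (label u) i≡j ij) (along p refl))

  reverseAlternating : ∀ {q r ℓ} → Alternating T label-edge q (leaf ℓ) →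
    Alternating T tree-edge q r → Alternating T tree-edge (leaf ℓ) r
  reverseAlternating [] acc = acc
  reverseAlternating (viaLabel {u} {i} {j} ij (viaTree p)) acc =
    reverseAlternating p (viaTree
      (subst (λ q → Alternating T label-edge q _) (sym (opposite-involutive (marker u j)))
        (viaLabel (adj-sym (label u) ij) acc)))

  -- No label-edge is incident to a leaf, so a nonempty sequence from a leaf begins with its
  -- tree-edge.
  Accessible⇔Reaches : ∀ {i j} → i ≢ j → Accessible T (leaf i) (leaf j) ⇔ Reaches (leaf i) j
  Accessible⇔Reaches i≢j = mk⇔
    (λ { (_ , []) → ⊥-elim (i≢j refl) ; (_ , viaTree p) → p })
    (λ p → tree-edge , viaTree p)

  Accessible-sym : ∀ {i j} → Accessible T (leaf i) (leaf j) → Accessible T (leaf j) (leaf i)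
  Accessible-sym (s , [])        = s , []
  Accessible-sym (_ , viaTree p) =
    tree-edge , reverseAlternating p (viaTree
      (subst (λ q → Alternating T label-edge q _) (sym (opposite-involutive _)) []))

  module States (G : Graph n) (acc : IsAccessibilityGraph T G) (S : Subset n) where

    A⇔Reaches : ∀ q {ℓ} → A T G q ℓ ⇔ Reaches q ℓ
    A⇔Reaches (leaf i) {ℓ} = mk⇔
      (λ iℓ → to (Accessible⇔Reaches (proj₁ (to (acc i ℓ) iℓ))) (proj₂ (to (acc i ℓ) iℓ)))
      (λ p → let i≢ℓ = λ i≡ℓ → from-L p (sym i≡ℓ) in
             from (acc i ℓ) (i≢ℓ , from (Accessible⇔Reaches i≢ℓ) p))
      where
      from-L : Reaches (leaf i) ℓ → ℓ ≢ i
      from-L p = from (L⇔Beyond (leaf i)) (Reaches⇒Beyond p)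
    A⇔Reaches q@(marker u i) {ℓ} = mk⇔ there
      (λ p → from (L⇔Beyond q) (Reaches⇒Beyond p) , tree-edge , viaTree p)
      where
      there : L T q ℓ × Accessible T q (leaf ℓ) → Reaches q ℓ
      there (_ , _ , viaTree p) = p
      -- A sequence beginning with a label-edge leaves `u` through another marker vertex, and so
      -- ends at a leaf that is not beyond `q`.
      there (l , _ , viaLabel ij (viaTree p)) =
        ⊥-elim (adj-irrefl (label u)
          (Beyond-unique (to (L⇔Beyond q) l) (Reaches⇒Beyond p)) ij)

    Perfect⇔ : ∀ q → Perfect T G S q ⇔ (∀ ℓ → (ℓ ∈ S × Beyond q ℓ) ⇔ Reaches q ℓ)
    Perfect⇔ q = mk⇔
      (λ p _ → mk⇔ (λ { (s , b) → to (A⇔Reaches q) (proj₁ p (s , from (L⇔Beyond q) b)) })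
                 (λ r → proj₁ (proj₂ p (from (A⇔Reaches q) r)) , Reaches⇒Beyond r))
      (λ p → (λ { (s , l) → from (A⇔Reaches q) (to (p _) (s , to (L⇔Beyond q) l)) })
           , (λ {_} a → proj₁ (from (p _) (to (A⇔Reaches q) a))
                      , from (L⇔Beyond q) (proj₂ (from (p _) (to (A⇔Reaches q) a)))))

    Empty⇔ : ∀ q → EmptyState T S q ⇔ (∀ ℓ → Beyond q ℓ → ℓ ∉ S)
    Empty⇔ q = mk⇔
      (λ e _ b s → e _ (s , from (L⇔Beyond q) b))
      (λ e _ sl → e _ (to (L⇔Beyond q) (proj₂ sl)) (proj₁ sl))

    -- Propagation of states across a node.

    module _ {u : Fin nodes} where

      -- A sequence that comes in through `i` and ends at a leaf beyond `j` must leave `u` through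
      -- `j`, by `Beyond-unique`; conversely the label-edge extends every sequence from `j`.
      perfect-adjacent : ∀ {i j} → Adj (label u) i j → Perfect T G S (opposite (marker u i)) →
        Perfect T G S (marker u j)
      perfect-adjacent {i} {j} ij p̄ = from (Perfect⇔ _) λ _ → mk⇔ there back
        where
        p = to (Perfect⇔ _) p̄

        there : ∀ {ℓ} → ℓ ∈ S × Beyond (marker u j) ℓ → Reaches (marker u j) ℓ
        there (s , b)
          with Reaches-branch (to (p _) (s , Beyond-across (λ i≡j → adj-irrefl (label u) i≡j ij) b))
        ... | k , _ , r with Beyond-unique b (Reaches⇒Beyond r)
        ...   | refl = r

        back : ∀ {ℓ} → Reaches (marker u j) ℓ → ℓ ∈ S × Beyond (marker u j) ℓ
        back r = proj₁ (from (p _) (Reaches-across ij r)) , Reaches⇒Beyond r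

      -- A leaf of `S` beyond `j` would be reached through `i`, hence by a label-edge from `i` to
      -- `j`.
      empty-nonadjacent : ∀ {i j} → i ≢ j → ¬ Adj (label u) i j →
        Perfect T G S (opposite (marker u i)) → EmptyState T S (marker u j)
      empty-nonadjacent {i} {j} i≢j ¬ij p = from (Empty⇔ _) λ _ b s → absurd b s
        where
        absurd : ∀ {ℓ} → Beyond (marker u j) ℓ → ℓ ∉ S
        absurd b s with Reaches-branch (to (to (Perfect⇔ _) p _) (s , Beyond-across i≢j b))
        ... | k , ik , r with Beyond-unique b (Reaches⇒Beyond r)
        ...   | refl = ¬ij ik

      empty-across : ∀ {i j} → i ≢ j → EmptyState T S (opposite (marker u i)) →
        EmptyState T S (marker u j)
      empty-across i≢j e = from (Empty⇔ _) λ _ b → to (Empty⇔ _) e _ (Beyond-across i≢j b)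

      -- Each leaf on the side of `u` lies beyond exactly one `k` other than `j`. Those beyond
      -- neighbours of `j` are right by perfection, and the others contain nothing of `S`.
      perfect-opposite : ∀ {j} → (∀ k → Adj (label u) j k → Perfect T G S (marker u k)) →
        (∀ k → j ≢ k → ¬ Adj (label u) j k → EmptyState T S (marker u k)) →
        Perfect T G S (opposite (marker u j))
      perfect-opposite {j} perf emp = from (Perfect⇔ _) λ _ → mk⇔ there back
        where
        there : ∀ {ℓ} → ℓ ∈ S × Beyond (opposite (marker u j)) ℓ → Reaches (opposite (marker u j)) ℓ
        there (s , b) with Beyond-branch b
        ... | k , j≢k , bₖ with adj? (label u) j k
        ...   | yes jk = Reaches-across jk (to (to (Perfect⇔ _) (perf k jk) _) (s , bₖ))
        ...   | no ¬jk = ⊥-elim (to (Empty⇔ _) (emp k j≢k ¬jk) _ bₖ s)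

        back : ∀ {ℓ} → Reaches (opposite (marker u j)) ℓ → ℓ ∈ S × Beyond (opposite (marker u j)) ℓ
        back r with Reaches-branch r
        ... | k , jk , rₖ = proj₁ (from (to (Perfect⇔ _) (perf k jk) _) rₖ) , Reaches⇒Beyond r

      empty-opposite : ∀ {j} → (∀ k → j ≢ k → EmptyState T S (marker u k)) →
        EmptyState T S (opposite (marker u j))
      empty-opposite emp = from (Empty⇔ _) λ _ b s →
        let k , j≢k , bₖ = Beyond-branch b in to (Empty⇔ _) (emp k j≢k) _ bₖ s

      -- Excludes a clique-join with the new node: adjacency to `i` makes every marker vertex
      -- perfect, and together they make every opposite perfect.
      clique-spreads : IsClique (label u) → ∀ {i} → Perfect T G S (marker u i) →
        Perfect T G S (opposite (marker u i)) → ∀ {j} → i ≢ j →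
        Perfect T G S (marker u j) × Perfect T G S (opposite (marker u j))
      clique-spreads clique {i} p p̄ {j} i≢j =
        all-perfect j , perfect-opposite (λ k _ → all-perfect k) (λ k j≢k ¬jk → ⊥-elim (¬jk (clique j≢k)))
        where
        all-perfect : ∀ k → Perfect T G S (marker u k)
        all-perfect k with i Fin.≟ k
        ... | yes refl = p
        ... | no i≢k   = perfect-adjacent (clique i≢k) p̄

      -- Excludes a star-join at the centre `i` of `u`. The only neighbour of the leg `j` is `i`,
      -- which is perfect, while all other legs are empty because their leaves lie beyond
      -- `opposite (marker u i)`.
      centre-spreads : ∀ {i} → IsStarCentre (label u) i → Perfect T G S (marker u i) →
        EmptyState T S (opposite (marker u i)) → ∀ {j} → i ≢ j →
        Perfect T G S (opposite (marker u j)) × EmptyState T S (marker u j)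
      centre-spreads {i} (_ , spoke , edge) p ē {j} i≢j =
        perfect-opposite perf emp , empty-across i≢j ē
        where
        perf : ∀ k → Adj (label u) j k → Perfect T G S (marker u k)
        perf k jk with edge jk
        ... | inj₁ j≡i  = ⊥-elim (i≢j (sym j≡i))
        ... | inj₂ refl = p

        emp : ∀ k → j ≢ k → ¬ Adj (label u) j k → EmptyState T S (marker u k)
        emp k _ ¬jk with i Fin.≟ k
        ... | yes refl = ⊥-elim (¬jk (adj-sym (label u) (spoke (i≢j ∘ sym))))
        ... | no i≢k = empty-across i≢k ē

      -- Excludes a star-join at a leg `i` of `u`. The centre inherits perfection from its neighbour
      -- `i`; the other legs are not adjacent to `i`, hence empty, as is `i` itself.
      leg-spreads : ∀ {i c} → IsStarCentre (label u) c → i ≢ c →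
        Perfect T G S (opposite (marker u i)) → EmptyState T S (marker u i) →
        Perfect T G S (marker u c) × EmptyState T S (opposite (marker u c))
      leg-spreads {i} {c} (_ , spoke , edge) i≢c p̄ e =
        perfect-adjacent (adj-sym (label u) (spoke i≢c)) p̄ , empty-opposite emp
        where
        emp : ∀ k → c ≢ k → EmptyState T S (marker u k)
        emp k c≢k with i Fin.≟ k
        ... | yes refl = e
        ... | no i≢k   =
          empty-nonadjacent i≢k ([ i≢c , c≢k ∘ sym ]′ ∘ edge) p̄

-- Extremities of the subdivided tree.

module Subdivision {n} {T : RawGLT n} (glt : IsGLT T) (q : Extremity n (RawGLT.degree T))
                   (H : Graph 3) where
  open RawGLT T
  open IsGLT glt
  open Tree glt using (reduced⇒notClosed; Reaches)

  T⁺ = subdivide T q H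
  module T⁺ = RawGLT T⁺
  open Walks T⁺ using (walk-++)

  Ext⁺ = Extremity (suc n) T⁺.degree

  embed : Extremity n degree → Ext⁺
  embed = old T q H

  opposite-embed : ∀ r → T⁺.opposite (embed r) ≡ opposite-old T q H r
  opposite-embed (leaf _)     = refl
  opposite-embed (marker _ _) = refl

  opposite-embed-q : T⁺.opposite (embed q) ≡ marker zero marker₁
  opposite-embed-q = trans (opposite-embed q) eq
    where
    eq : opposite-old T q H q ≡ marker zero marker₁
    eq with q ≟ q | q ≟ opposite q
    ... | yes _  | _ = refl
    ... | no q≢q | _ = ⊥-elim (q≢q refl)

  opposite-embed-q̄ : T⁺.opposite (embed (opposite q)) ≡ marker zero marker₂
  opposite-embed-q̄ = trans (opposite-embed (opposite q)) eq
    where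
    eq : opposite-old T q H (opposite q) ≡ marker zero marker₂
    eq with opposite q ≟ q | opposite q ≟ opposite q
    ... | yes q̄≡q | _      = ⊥-elim (opposite-distinct q q̄≡q)
    ... | no _    | yes _  = refl
    ... | no _    | no q̄≢q̄ = ⊥-elim (q̄≢q̄ refl)

  opposite-embed-other : ∀ {r} → r ≢ q → r ≢ opposite q →
    T⁺.opposite (embed r) ≡ embed (opposite r)
  opposite-embed-other {r} r≢q r≢q̄ = trans (opposite-embed r) eq
    where
    eq : opposite-old T q H r ≡ embed (opposite r)
    eq with r ≟ q | r ≟ opposite q
    ... | yes r≡q | _       = ⊥-elim (r≢q r≡q)
    ... | no _    | yes r≡q̄ = ⊥-elim (r≢q̄ r≡q̄)
    ... | no _    | no _    = refl

  -- Mirrors the three branches of `opposite-old`, so that matching on it selects the equation for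
  -- `opposite` that applies.
  data Position (r : Extremity n degree) : Set where
    at-q  : r ≡ q → Position r
    at-q̄  : r ≡ opposite q → Position r
    other : r ≢ q → r ≢ opposite q → Position r

  position : ∀ r → Position r
  position r with r ≟ q | r ≟ opposite q
  ... | yes r≡q | _       = at-q r≡q
  ... | no _    | yes r≡q̄ = at-q̄ r≡q̄
  ... | no r≢q  | no r≢q̄  = other r≢q r≢q̄

  opposite≢q : ∀ {r} → r ≢ opposite q → opposite r ≢ q
  opposite≢q r≢q̄ refl = r≢q̄ (sym (opposite-involutive _))

  opposite≢q̄ : ∀ {r} → r ≢ q → opposite r ≢ opposite q
  opposite≢q̄ {r} r≢q eq =
    r≢q (trans (sym (opposite-involutive r)) (trans (cong opposite eq) (opposite-involutive q)))

  data View : Ext⁺ → Set where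
    new-leaf   : View (leaf zero)
    new-marker : ∀ i → View (marker zero i)
    embedded   : ∀ r → View (embed r)

  view : ∀ a → View a
  view (leaf zero)        = new-leaf
  view (leaf (suc ℓ))     = embedded (leaf ℓ)
  view (marker zero i)    = new-marker i
  view (marker (suc u) i) = embedded (marker u i)

  opposite⁺-involutive : ∀ a → T⁺.opposite (T⁺.opposite a) ≡ a
  opposite⁺-involutive a with view a
  ... | new-leaf                    = refl
  ... | new-marker zero             = refl
  ... | new-marker (suc zero)       = opposite-embed-q
  ... | new-marker (suc (suc zero)) = opposite-embed-q̄
  ... | embedded r with position r
  ...   | at-q refl = cong T⁺.opposite opposite-embed-q
  ...   | at-q̄ refl = cong T⁺.opposite opposite-embed-q̄
  ...   | other r≢q r≢q̄ =
    trans (cong T⁺.opposite (opposite-embed-other r≢q r≢q̄))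
      (trans (opposite-embed-other (opposite≢q r≢q̄) (opposite≢q̄ r≢q))
        (cong embed (opposite-involutive r)))

  embed≢new : ∀ r {i} → embed r ≢ marker zero i
  embed≢new (leaf _)     ()
  embed≢new (marker _ _) ()

  embed-injective : ∀ {r s} → embed r ≡ embed s → r ≡ s
  embed-injective {leaf _}     {leaf _}     refl = refl
  embed-injective {marker _ _} {marker _ _} refl = refl

  opposite⁺-distinct : ∀ a → T⁺.opposite a ≢ a
  opposite⁺-distinct a with view a
  ... | new-leaf                    = λ ()
  ... | new-marker zero             = λ ()
  ... | new-marker (suc zero)       = embed≢new q
  ... | new-marker (suc (suc zero)) = embed≢new (opposite q)
  ... | embedded r with position r
  ...   | at-q refl = λ eq → embed≢new q (trans (sym eq) opposite-embed-q)
  ...   | at-q̄ refl = λ eq → embed≢new (opposite q) (trans (sym eq) opposite-embed-q̄)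
  ...   | other r≢q r≢q̄ =
    λ eq → opposite-distinct r (embed-injective (trans (sym (opposite-embed-other r≢q r≢q̄)) eq))

  -- Connectedness of the subdivided tree.

  Joined : Rel (TreeVertex (suc n) T⁺.nodes) 0ℓ
  Joined v w = ∃ (IsWalk T⁺ v w)

  joined-trans : ∀ {u v w} → Joined u v → Joined v w → Joined u w
  joined-trans (as , V) (bs , W) = as ++ bs , walk-++ as V W

  joined-edge : ∀ {a b} → T⁺.opposite a ≡ b → Joined (T⁺.end a) (T⁺.end b)
  joined-edge {a} refl = a ∷ [] , refl , refl

  ι : TreeVertex n nodes → TreeVertex (suc n) T⁺.nodes
  ι (leaf ℓ) = leaf (suc ℓ)
  ι (node u) = node (suc u)

  end-embed : ∀ r → T⁺.end (embed r) ≡ ι (end r)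
  end-embed (leaf _)     = refl
  end-embed (marker _ _) = refl

  -- The subdivided edge is replaced by a two-step walk through the new node; every other tree-edge
  -- is kept.
  joined-embed : ∀ r → Joined (ι (end r)) (ι (end (opposite r)))
  joined-embed r = subst₂ Joined (end-embed r) (end-embed (opposite r)) (across (position r))
    where
    across : Position r → Joined (T⁺.end (embed r)) (T⁺.end (embed (opposite r)))
    across (at-q refl) =
      joined-trans (joined-edge opposite-embed-q) (joined-edge {a = marker zero marker₂} refl)
    across (at-q̄ refl) =
      joined-trans (joined-edge opposite-embed-q̄)
        (joined-edge {a = marker zero marker₁} (cong embed (sym (opposite-involutive q))))
    across (other r≢q r≢q̄) = joined-edge (opposite-embed-other r≢q r≢q̄)

  joined-ι : ∀ {v w} → Joined (ι v) (ι w)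
  joined-ι {v} {w} with proj₁ isTree v w
  ... | qs , W = along qs W
    where
    along : ∀ qs {v w} → IsWalk T v w qs → Joined (ι v) (ι w)
    along []       refl       = [] , refl
    along (r ∷ rs) (refl , W) = joined-trans (joined-embed r) (along rs W)

  -- The contraction of the path between x, the new node and the end of q to the last of these.
  π : TreeVertex (suc n) T⁺.nodes → TreeVertex n nodes
  π (leaf zero)    = end q
  π (leaf (suc ℓ)) = leaf ℓ
  π (node zero)    = end q
  π (node (suc u)) = node u

  new⇒q : Joined (node zero) (ι (end q))
  new⇒q = subst (Joined (node zero)) (end-embed q) (joined-edge {a = marker zero marker₁} refl)

  q⇒new : Joined (ι (end q)) (node zero)
  q⇒new = subst (λ v → Joined v (node zero)) (end-embed q) (joined-edge opposite-embed-q)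

  joined-π : ∀ v → Joined v (ι (π v)) × Joined (ι (π v)) v
  joined-π (leaf zero)    =
    joined-trans (joined-edge {a = leaf zero} refl) new⇒q
    , joined-trans q⇒new (joined-edge {a = marker zero markerˣ} refl)
  joined-π (leaf (suc _)) = ([] , refl) , ([] , refl)
  joined-π (node zero)    = new⇒q , q⇒new
  joined-π (node (suc _)) = ([] , refl) , ([] , refl)

  T⁺-connected : TreeConnected T⁺
  T⁺-connected v w =
    joined-trans (proj₁ (joined-π v)) (joined-trans joined-ι (proj₂ (joined-π w)))

  -- Acyclicity of the subdivided tree.

  -- Of the two halves of the subdivided edge, the one at q is contracted and the other is the
  -- lift of {q , opposite q}.
  lift : Extremity n degree → Ext⁺
  lift r with r ≟ q
  ... | yes _ = marker zero marker₂
  ... | no _  = embed r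

  lift-q : lift q ≡ marker zero marker₂
  lift-q with q ≟ q
  ... | yes _  = refl
  ... | no q≢q = ⊥-elim (q≢q refl)

  lift-other : ∀ {r} → r ≢ q → lift r ≡ embed r
  lift-other {r} r≢q with r ≟ q
  ... | yes r≡q = ⊥-elim (r≢q r≡q)
  ... | no _    = refl

  opposite-lift : ∀ r → T⁺.opposite (lift r) ≡ lift (opposite r)
  opposite-lift r with position r
  ... | at-q refl = trans (cong T⁺.opposite lift-q) (sym (lift-other (opposite-distinct q)))
  ... | at-q̄ refl =
    trans (cong T⁺.opposite (lift-other (opposite-distinct q)))
      (trans opposite-embed-q̄ (sym (trans (cong lift (opposite-involutive q)) lift-q)))
  ... | other r≢q r≢q̄ =
    trans (cong T⁺.opposite (lift-other r≢q))
      (trans (opposite-embed-other r≢q r≢q̄) (sym (lift-other (opposite≢q r≢q̄))))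

  π-ι : ∀ v → π (ι v) ≡ v
  π-ι (leaf _) = refl
  π-ι (node _) = refl

  π-embed : ∀ r → π (T⁺.end (embed r)) ≡ end r
  π-embed r = trans (cong π (end-embed r)) (π-ι (end r))

  π-lift : ∀ r → π (T⁺.end (lift r)) ≡ end r
  π-lift r with r ≟ q
  ... | yes refl = refl
  ... | no _     = π-embed r

  π-opposite-lift : ∀ r → π (T⁺.end (T⁺.opposite (lift r))) ≡ end (opposite r)
  π-opposite-lift r = trans (cong (π ∘ T⁺.end) (opposite-lift r)) (π-lift (opposite r))

  -- The four extremities of the two tree-edges that `π` contracts: the edge at `x` and the half of
  -- the subdivided edge at `q`.
  data Collapsed : Ext⁺ → Set where
    leafˣ  : Collapsed (leaf zero)
    nodeˣ  : Collapsed (marker zero markerˣ)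
    node-q : Collapsed (marker zero marker₁)
    end-q  : Collapsed (embed q)

  lifted-or-collapsed : ∀ a → (∃[ r ] a ≡ lift r) ⊎ Collapsed a
  lifted-or-collapsed a with view a
  ... | new-leaf                    = inj₂ leafˣ
  ... | new-marker zero             = inj₂ nodeˣ
  ... | new-marker (suc zero)       = inj₂ node-q
  ... | new-marker (suc (suc zero)) = inj₁ (q , sym lift-q)
  ... | embedded r with r ≟ q
  ...   | yes refl = inj₂ end-q
  ...   | no r≢q   = inj₁ (r , sym (lift-other r≢q))

  π-collapsed : ∀ {a} → Collapsed a → π (T⁺.end a) ≡ π (T⁺.end (T⁺.opposite a))
  π-collapsed leafˣ  = refl
  π-collapsed nodeˣ  = refl
  π-collapsed node-q = sym (π-embed q)
  π-collapsed end-q  = trans (π-embed q) (cong (π ∘ T⁺.end) (sym opposite-embed-q))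

  Trail : Pred (List (Extremity n degree)) 0ℓ
  Trail = AllPairs λ r s → ¬ SameEdge T r s

  Trail⁺ : Pred (List Ext⁺) 0ℓ
  Trail⁺ = AllPairs λ a b → ¬ SameEdge T⁺ a b

  SameEdge-lift : ∀ {r s} → SameEdge T r s → SameEdge T⁺ (lift r) (lift s)
  SameEdge-lift (inj₁ refl) = inj₁ refl
  SameEdge-lift (inj₂ refl) = inj₂ (sym (opposite-lift _))

  -- The clause quantified over P says that the lift of rs is contained in as.
  contract : ∀ as {v w} → IsWalk T⁺ v w as → Trail⁺ as →
    ∃[ rs ] IsWalk T (π v) (π w) rs × Trail rs
      × (∀ {P : Pred Ext⁺ 0ℓ} → All P as → All (P ∘ lift) rs)
      × (rs ≡ [] → All Collapsed as)
  contract []       refl       _        = [] , refl , [] , (λ _ → []) , (λ _ → [])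
  contract (a ∷ as) (refl , W) (p ∷ tr) with contract as W tr | lifted-or-collapsed a
  ... | rs , V , trᵣ , tf , em | inj₁ (r , refl) =
    r ∷ rs
    , (sym (π-lift r) , subst (λ v → IsWalk T v _ rs) (π-opposite-lift r) V)
    -- A repeated tree-edge in the contraction would lift to a repeated one in `a ∷ as`.
    , All.map (_∘ SameEdge-lift) (tf p) ∷ trᵣ
    , (λ { (x ∷ xs) → x ∷ tf xs })
    , λ ()
  ... | rs , V , trᵣ , tf , em | inj₂ c =
    rs
    , subst (λ v → IsWalk T v _ rs) (sym (π-collapsed c)) V
    , trᵣ
    , (λ { (_ ∷ xs) → tf xs })
    , λ eq → c ∷ em eq

  end-embed≢ : ∀ r {v} → T⁺.end (embed r) ≡ v → v ≢ node zero × v ≢ leaf zero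
  end-embed≢ (leaf _)     refl = (λ ()) , (λ ())
  end-embed≢ (marker _ _) refl = (λ ()) , (λ ())

  -- The contracted edges form a path from `x` through the new node to the end of `q`. A trail on a
  -- path cannot turn back, so it gets stuck at one of the two ends.
  collapsed⇒notClosed : ∀ a as {v} → IsWalk T⁺ v v (a ∷ as) → Trail⁺ (a ∷ as) →
    ¬ All Collapsed (a ∷ as)
  collapsed⇒notClosed a as (start , W) (p ∷ tr) (c ∷ cs) = first c start as W p tr cs
    where
    after-node-q : ∀ {c} → Collapsed c → T⁺.end c ≡ T⁺.end (embed q) →
      SameEdge T⁺ (marker zero marker₁) c
    after-node-q leafˣ  eq = ⊥-elim (proj₂ (end-embed≢ q (sym eq)) refl)
    after-node-q nodeˣ  eq = ⊥-elim (proj₁ (end-embed≢ q (sym eq)) refl)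
    after-node-q node-q _  = inj₁ refl
    after-node-q end-q  _  = inj₂ refl

    after-nodeˣ : ∀ {c} → Collapsed c → T⁺.end c ≡ leaf zero → SameEdge T⁺ (marker zero markerˣ) c
    after-nodeˣ leafˣ _  = inj₂ refl
    after-nodeˣ end-q eq = ⊥-elim (proj₂ (end-embed≢ q eq) refl)

    first : ∀ {a} → Collapsed a → ∀ {v} → T⁺.end a ≡ v → ∀ as →
      IsWalk T⁺ (T⁺.end (T⁺.opposite a)) v as → All (λ b → ¬ SameEdge T⁺ a b) as →
      Trail⁺ as → ¬ All Collapsed as
    first leafˣ refl (b ∷ []) (_ , W) (p ∷ _) _ (nodeˣ ∷ _)  = p (inj₂ refl)
    first leafˣ refl (b ∷ []) (_ , W) (p ∷ _) _ (node-q ∷ _) = proj₂ (end-embed≢ q W) refl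
    first leafˣ refl (b ∷ _ ∷ _) _ (p ∷ _) _ (nodeˣ ∷ _) = p (inj₂ refl)
    first leafˣ refl (b ∷ _ ∷ _) (_ , eq , _) _ ((p ∷ _) ∷ _) (node-q ∷ c ∷ _) =
      p (after-node-q c eq)
    first leafˣ refl (b ∷ as) (eq , _) _ _ (end-q ∷ _) = proj₁ (end-embed≢ q eq) refl
    first nodeˣ refl (b ∷ as) (eq , _) (p ∷ _) _ (c ∷ _) = p (after-nodeˣ c eq)
    first node-q refl []       W _ _ _ = proj₁ (end-embed≢ q W) refl
    first node-q refl (b ∷ as) (eq , _) (p ∷ _) _ (c ∷ _) = p (after-node-q c eq)
    first end-q refl [] W _ _ _ =
      proj₁ (end-embed≢ q (trans (sym W) (cong T⁺.end opposite-embed-q))) refl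
    -- Having come from the end of `q` to the new node, the trail can only go on to `x`, and there
    -- it is stuck.
    first end-q refl (b ∷ as) W p tr cs = go b as W p tr cs
      where
      go : ∀ b as → IsWalk T⁺ (T⁺.end (T⁺.opposite (embed q))) (T⁺.end (embed q)) (b ∷ as) →
        All (λ b → ¬ SameEdge T⁺ (embed q) b) (b ∷ as) → Trail⁺ (b ∷ as) →
        ¬ All Collapsed (b ∷ as)
      go b as (eq , W) ps trs (c ∷ cs) with trans eq (cong T⁺.end opposite-embed-q)
      go _ as (eq , W) (p ∷ _) _ (node-q ∷ _) | _ = p (inj₂ (sym opposite-embed-q))
      go _ as (eq , W) (p ∷ _) _ (end-q ∷ _) | eq′ = proj₁ (end-embed≢ q eq′) refl
      go _ [] (eq , W) _ _ (nodeˣ ∷ _) | _ = proj₂ (end-embed≢ q (sym W)) refl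
      go _ (_ ∷ _) (eq , eq′ , _) _ ((p ∷ _) ∷ _) (nodeˣ ∷ c ∷ _) | _ = p (after-nodeˣ c eq′)

  -- A cycle contracts to a closed trail. If this is empty, the cycle lies on the contracted path;
  -- otherwise it is a closed walk without backtracking in `T`, as backtracking repeats a tree-edge.
  T⁺-acyclic : ∀ as → ¬ IsCycle T⁺ as
  T⁺-acyclic []       (as≢[] , _) = as≢[] refl
  T⁺-acyclic (a ∷ as) (_ , (v , W) , _ , tr) with contract (a ∷ as) W tr
  ... | []     , _ , _   , _ , em = collapsed⇒notClosed a as W tr (em refl)
  ... | r ∷ rs , V , trᵣ , _      =
    reduced⇒notClosed r rs V (AllPairs⇒Linked (AllPairs.map (_∘ inj₂) trᵣ))

  isGLT⁺ : IsGLT T⁺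
  isGLT⁺ = record
    { opposite-involutive = opposite⁺-involutive
    ; opposite-distinct   = opposite⁺-distinct
    ; degree≥3            = λ { zero → s≤s (s≤s (s≤s z≤n)) ; (suc u) → degree≥3 u }
    ; isTree              = T⁺-connected , T⁺-acyclic
    }

  -- Joins in the subdivided tree.

  -- The places where a join could happen, in both orientations. The marker vertex `markerˣ` is
  -- absent because its opposite is a leaf.
  data NodeEdge : (u : Fin (suc nodes)) → Fin (T⁺.degree u) →
                  (v : Fin (suc nodes)) → Fin (T⁺.degree v) → Set where
    old-old : ∀ {u i v j} → opposite (marker u i) ≡ marker v j → NodeEdge (suc u) i (suc v) j
    new-q   : ∀ {u i} → q ≡ marker u i → NodeEdge zero marker₁ (suc u) i
    new-q̄   : ∀ {u i} → opposite q ≡ marker u i → NodeEdge zero marker₂ (suc u) i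
    q-new   : ∀ {u i} → q ≡ marker u i → NodeEdge (suc u) i zero marker₁
    q̄-new   : ∀ {u i} → opposite q ≡ marker u i → NodeEdge (suc u) i zero marker₂

  embed≡marker : ∀ {r u i} → embed r ≡ marker (suc u) i → r ≡ marker u i
  embed≡marker {marker _ _} refl = refl

  nodeEdge : ∀ {u i v j} → T⁺.opposite (marker u i) ≡ marker v j → NodeEdge u i v j
  nodeEdge {zero} {suc zero}       {zero} eq = ⊥-elim (embed≢new q eq)
  nodeEdge {zero} {suc zero}       {suc v} eq = new-q (embed≡marker eq)
  nodeEdge {zero} {suc (suc zero)} {zero} eq = ⊥-elim (embed≢new (opposite q) eq)
  nodeEdge {zero} {suc (suc zero)} {suc v} eq = new-q̄ (embed≡marker eq)
  nodeEdge {suc u} {i} eq with position (marker u i)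
  ... | at-q r≡q with trans (sym eq) (trans (cong (T⁺.opposite ∘ embed) r≡q) opposite-embed-q)
  ...   | refl = q-new (sym r≡q)
  nodeEdge {suc u} {i} eq | at-q̄ r≡q̄
    with trans (sym eq) (trans (cong (T⁺.opposite ∘ embed) r≡q̄) opposite-embed-q̄)
  ...   | refl = q̄-new (sym r≡q̄)
  nodeEdge {suc u} {i} {zero} eq | other r≢q r≢q̄ =
    ⊥-elim (embed≢new _ (trans (sym (opposite-embed-other r≢q r≢q̄)) eq))
  nodeEdge {suc u} {i} {suc v} eq | other r≢q r≢q̄ =
    old-old (embed≡marker (trans (sym (opposite-embed-other r≢q r≢q̄)) eq))

  StarJoinable : ∀ {m k} → Graph m → Fin m → Graph k → Fin k → Set
  StarJoinable G i H j = IsStar G × IsStar H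
    × ((IsStarCentre G i × ¬ IsStarCentre H j) ⊎ (¬ IsStarCentre G i × IsStarCentre H j))

  StarJoinable-sym : ∀ {m k} (G : Graph m) i (H : Graph k) j →
    StarJoinable G i H j → StarJoinable H j G i
  StarJoinable-sym _ _ _ _ (s , t , inj₁ (c , ¬d)) = t , s , inj₂ (¬d , c)
  StarJoinable-sym _ _ _ _ (s , t , inj₂ (¬c , d)) = t , s , inj₁ (d , ¬c)

  -- A tree-edge between two old nodes is already one of `T`, so only the two halves of the
  -- subdivided edge could permit a new join.
  isReduced⁺ : IsReduced T → IsDegenerate H →
    (IsClique H → ∀ {u i} → q ≡ marker u i ⊎ opposite q ≡ marker u i → ¬ IsClique (label u)) →
    (∀ {u i} → q ≡ marker u i → ¬ StarJoinable H marker₁ (label u) i) →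
    (∀ {u i} → opposite q ≡ marker u i → ¬ StarJoinable H marker₂ (label u) i) →
    IsReduced T⁺
  isReduced⁺ (labels , ¬clique , ¬star) deg ¬cliqueᴴ ¬star₁ ¬star₂ =
    (λ { zero → inj₂ deg ; (suc u) → labels u })
    , (λ { (u , i , v , j , eq , cu , cv) → noClique (nodeEdge {u} {i} eq) cu cv })
    , (λ { (u , i , v , j , eq , st) → noStar (nodeEdge {u} {i} eq) st })
    where
    noClique : ∀ {u i v j} → NodeEdge u i v j → IsClique (T⁺.label u) → ¬ IsClique (T⁺.label v)
    noClique (old-old eq) cu cv = ¬clique (_ , _ , _ , _ , eq , cu , cv)
    noClique (new-q eq)   cu cv = ¬cliqueᴴ cu (inj₁ eq) cv
    noClique (new-q̄ eq)   cu cv = ¬cliqueᴴ cu (inj₂ eq) cv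
    noClique (q-new eq)   cu cv = ¬cliqueᴴ cv (inj₁ eq) cu
    noClique (q̄-new eq)   cu cv = ¬cliqueᴴ cv (inj₂ eq) cu

    noStar : ∀ {u i v j} → NodeEdge u i v j → ¬ StarJoinable (T⁺.label u) i (T⁺.label v) j
    noStar (old-old eq) st = ¬star (_ , _ , _ , _ , eq , st)
    noStar (new-q eq)   st = ¬star₁ eq st
    noStar (new-q̄ eq)   st = ¬star₂ eq st
    noStar {suc u} {i} (q-new eq) st = ¬star₁ eq (StarJoinable-sym (label u) i H marker₁ st)
    noStar {suc u} {i} (q̄-new eq) st = ¬star₂ eq (StarJoinable-sym (label u) i H marker₂ st)

  -- Accessibility after the subdivision.

  module Accessibility (₁∼₂ : Adj H marker₁ marker₂) where

    -- A sequence crossing the subdivided edge makes a detour over the label-edge between `marker₁`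
    -- and `marker₂`.
    enter : ∀ {r z} → Alternating T⁺ label-edge (embed (opposite r)) z →
      Alternating T⁺ label-edge (T⁺.opposite (embed r)) z
    enter {r} {z} p with position r
    ... | at-q refl = subst (λ a → Alternating T⁺ label-edge a z) (sym opposite-embed-q)
      (viaLabel ₁∼₂ (viaTree p))
    ... | at-q̄ refl = subst (λ a → Alternating T⁺ label-edge a z) (sym opposite-embed-q̄)
      (viaLabel (adj-sym H ₁∼₂) (viaTree
        (subst (λ r → Alternating T⁺ label-edge (embed r) z) (opposite-involutive q) p)))
    ... | other r≢q r≢q̄ =
      subst (λ a → Alternating T⁺ label-edge a z) (sym (opposite-embed-other r≢q r≢q̄)) p

    embed-alternating : ∀ {a ℓ} → Alternating T label-edge a (leaf ℓ) →
      Alternating T⁺ label-edge (embed a) (leaf (suc ℓ))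
    embed-alternating [] = []
    embed-alternating (viaLabel {u} {i} {j} ij (viaTree p)) =
      viaLabel {u = suc u} ij (viaTree (enter {marker u j} (embed-alternating p)))

    not-through-x : ∀ {ℓ} → ¬ Alternating T⁺ label-edge (leaf zero) (leaf (suc ℓ))
    not-through-x ()

    mutual
      -- Inverse of the detour: at the new node the sequence must cross to the other half of the
      -- subdivided edge, since at `x` it would be stuck. The start is given by an equation because
      -- `embed` cannot be matched as an index.
      project : ∀ {a b ℓ} → Alternating T⁺ label-edge b (leaf (suc ℓ)) → b ≡ embed a →
        Alternating T label-edge a (leaf ℓ)
      project {leaf _} [] refl = []
      project {marker u i} (viaLabel {j = j} ij (viaTree p)) refl =
        viaLabel ij (viaTree (project-across (position (marker u j)) p))

      project-across : ∀ {r ℓ} → Position r →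
        Alternating T⁺ label-edge (T⁺.opposite (embed r)) (leaf (suc ℓ)) →
        Alternating T label-edge (opposite r) (leaf ℓ)
      project-across (at-q refl) p = project₁ p opposite-embed-q
      project-across (at-q̄ refl) p =
        subst (λ r → Alternating T label-edge r _) (sym (opposite-involutive q))
          (project₂ p opposite-embed-q̄)
      project-across (other r≢q r≢q̄) p = project p (opposite-embed-other r≢q r≢q̄)

      project₁ : ∀ {b ℓ} → Alternating T⁺ label-edge b (leaf (suc ℓ)) → b ≡ marker zero marker₁ →
        Alternating T label-edge (opposite q) (leaf ℓ)
      project₁ (viaLabel {j = zero}           _  (viaTree p)) refl = ⊥-elim (not-through-x p)
      project₁ (viaLabel {j = suc zero}       ij _)           refl = ⊥-elim (adj-irrefl H refl ij)
      project₁ (viaLabel {j = suc (suc zero)} _  (viaTree p)) refl = project p refl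

      project₂ : ∀ {b ℓ} → Alternating T⁺ label-edge b (leaf (suc ℓ)) → b ≡ marker zero marker₂ →
        Alternating T label-edge q (leaf ℓ)
      project₂ (viaLabel {j = zero}           _  (viaTree p)) refl = ⊥-elim (not-through-x p)
      project₂ (viaLabel {j = suc zero}       _  (viaTree p)) refl = project p refl
      project₂ (viaLabel {j = suc (suc zero)} ij _)           refl = ⊥-elim (adj-irrefl H refl ij)

    module Tᵍ = Tree glt
    module T⁺ᵍ = Tree isGLT⁺

    reaches-old : ∀ {i j} → T⁺ᵍ.Reaches (leaf (suc i)) (suc j) ⇔ Reaches (leaf i) j
    reaches-old {i} = mk⇔ (project-across (position (leaf i)))
      (λ p → enter {leaf i} (embed-alternating p))

    -- The indices cross over: `marker₁` leads to the end of `q`, hence to what is reached from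
    -- `opposite q`, and `marker₂` leads to what is reached from `q`.
    reaches-x : ∀ {ℓ} → T⁺ᵍ.Reaches (leaf zero) (suc ℓ) ⇔
      (Adj H markerˣ marker₁ × Reaches (opposite q) ℓ ⊎ Adj H markerˣ marker₂ × Reaches q ℓ)
    reaches-x {ℓ} = mk⇔ there back
      where
      there : T⁺ᵍ.Reaches (leaf zero) (suc ℓ) →
        Adj H markerˣ marker₁ × Reaches (opposite q) ℓ ⊎ Adj H markerˣ marker₂ × Reaches q ℓ
      there (viaLabel {j = zero} ij _) = ⊥-elim (adj-irrefl H refl ij)
      there (viaLabel {j = suc zero} ij (viaTree p)) =
        inj₁ (ij , project p (cong embed (sym (opposite-involutive q))))
      there (viaLabel {j = suc (suc zero)} ij (viaTree p)) = inj₂ (ij , project p refl)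

      back : Adj H markerˣ marker₁ × Reaches (opposite q) ℓ ⊎ Adj H markerˣ marker₂ × Reaches q ℓ →
        T⁺ᵍ.Reaches (leaf zero) (suc ℓ)
      back (inj₁ (ij , p)) = viaLabel ij (viaTree (embed-alternating
        (subst (λ r → Alternating T label-edge r (leaf ℓ)) (opposite-involutive q) p)))
      back (inj₂ (ij , p)) = viaLabel ij (viaTree (embed-alternating p))

    isAccessibilityGraph⁺ : ∀ G {S} → IsAccessibilityGraph T G →
      (∀ ℓ → ℓ ∈ S ⇔
        (Adj H markerˣ marker₁ × Reaches (opposite q) ℓ ⊎ Adj H markerˣ marker₂ × Reaches q ℓ)) →
      IsAccessibilityGraph T⁺ (addVertex G S)
    isAccessibilityGraph⁺ G {S} acc S⇔ = adj⇔
      where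
      x⇔ : ∀ ℓ → ℓ ∈ S ⇔ Accessible T⁺ (leaf zero) (leaf (suc ℓ))
      x⇔ ℓ = mk⇔
        (from (T⁺ᵍ.Accessible⇔Reaches λ ()) ∘ from reaches-x ∘ to (S⇔ ℓ))
        (from (S⇔ ℓ) ∘ to reaches-x ∘ to (T⁺ᵍ.Accessible⇔Reaches λ ()))

      adj⇔ : IsAccessibilityGraph T⁺ (addVertex G S)
      adj⇔ zero    zero    = mk⇔ (λ ()) (λ { (z≢z , _) → z≢z refl })
      adj⇔ zero    (suc ℓ) = mk⇔ (λ s → (λ ()) , to (x⇔ ℓ) s) (from (x⇔ ℓ) ∘ proj₂)
      adj⇔ (suc ℓ) zero    = mk⇔
        (λ s → (λ ()) , T⁺ᵍ.Accessible-sym (to (x⇔ ℓ) s))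
        (from (x⇔ ℓ) ∘ T⁺ᵍ.Accessible-sym ∘ proj₂)
      adj⇔ (suc i) (suc j) = mk⇔
        (λ ij → let i≢j , p = to (acc i j) ij in
          (i≢j ∘ suc-injective)
          , from (T⁺ᵍ.Accessible⇔Reaches (i≢j ∘ suc-injective))
              (from reaches-old (to (Tᵍ.Accessible⇔Reaches i≢j) p)))
        (λ { (si≢sj , p) → from (acc i j)
          ( si≢sj ∘ cong suc
          , from (Tᵍ.Accessible⇔Reaches (si≢sj ∘ cong suc))
              (to reaches-old (to (T⁺ᵍ.Accessible⇔Reaches si≢sj) p))) })

-- The new clique node and the new star node.

another : ∀ {m} → 3 ≤ m → (i : Fin m) → ∃[ j ] i ≢ j
another (s≤s (s≤s _)) zero    = suc zero , λ ()
another (s≤s (s≤s _)) (suc _) = zero , λ ()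

module NewNode {n} {G : Graph n} {S : Subset n} {T : RawGLT n} (st : IsSplitTree T G)
               (q : Extremity n (RawGLT.degree T)) where
  open RawGLT T
  glt     = proj₁ st
  reduced = proj₁ (proj₂ st)
  acc     = proj₂ (proj₂ st)
  open IsGLT glt
  open Tree glt
  open States G acc S

  cliqueNode : UniqueEdge T (λ r → Perfect T G S r × Perfect T G S (opposite r)) q →
    IsSplitTree (subdivide T q (complete 3)) (addVertex G S)
  cliqueNode ((p , p̄) , unique) =
    isGLT⁺ , isReduced⁺ reduced (inj₁ λ i≢j → i≢j) ¬cliqueJoin (λ _ → ¬star ∘ proj₁) (λ _ → ¬star ∘ proj₁)
    , Accessibility.isAccessibilityGraph⁺ (λ ()) G acc S⇔
    where
    open Subdivision glt q (complete 3)

    -- Whichever vertex is taken as the centre, the other two are adjacent.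
    ¬star : ¬ IsStar (complete 3)
    ¬star (zero , _ , _ , edge) with edge {marker₁} {marker₂} (λ ())
    ... | inj₁ ()
    ... | inj₂ ()
    ¬star (suc zero , _ , _ , edge) with edge {markerˣ} {marker₂} (λ ())
    ... | inj₁ ()
    ... | inj₂ ()
    ¬star (suc (suc zero) , _ , _ , edge) with edge {markerˣ} {marker₁} (λ ())
    ... | inj₁ ()
    ... | inj₂ ()

    -- Another marker vertex `j` of `u` would have both extremities of its tree-edge perfect. By
    -- uniqueness this edge is that of `i`, although distinct marker vertices of a node lie on
    -- distinct tree-edges.
    contradicted : ∀ {u i} → SameEdge T (marker u i) q → Perfect T G S (marker u i) →
      Perfect T G S (opposite (marker u i)) → ¬ IsClique (label u)
    contradicted {u} {i} e p p̄ clique with another (degree≥3 u) i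
    ... | j , i≢j with unique (marker u j) (clique-spreads clique p p̄ i≢j) | e
    ...   | same | inj₁ refl = distinct-markers i≢j same
    ...   | same | inj₂ refl = distinct-markers i≢j
      (subst (λ r → SameEdge T r (marker u j)) (opposite-involutive (marker u i))
        (SameEdge-oppositeˡ same))

    ¬cliqueJoin : IsClique (complete 3) → ∀ {u i} → q ≡ marker u i ⊎ opposite q ≡ marker u i →
      ¬ IsClique (label u)
    ¬cliqueJoin _ (inj₁ refl) = contradicted (inj₁ refl) p p̄
    ¬cliqueJoin _ (inj₂ eq)   = contradicted
      (inj₂ (trans (sym (opposite-involutive q)) (cong opposite eq)))
      (subst (Perfect T G S) eq p̄)
      (subst (Perfect T G S) (trans (sym (opposite-involutive q)) (cong opposite eq)) p)

    S⇔ : ∀ ℓ → ℓ ∈ S ⇔ (markerˣ ≢ marker₁ × Reaches (opposite q) ℓ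
                       ⊎ markerˣ ≢ marker₂ × Reaches q ℓ)
    S⇔ ℓ = mk⇔ there back
      where
      there : ℓ ∈ S → markerˣ ≢ marker₁ × Reaches (opposite q) ℓ ⊎ markerˣ ≢ marker₂ × Reaches q ℓ
      there s with Beyond-cover q ℓ
      ... | inj₁ b = inj₂ ((λ ()) , to (to (Perfect⇔ _) p ℓ) (s , b))
      ... | inj₂ b = inj₁ ((λ ()) , to (to (Perfect⇔ _) p̄ ℓ) (s , b))

      back : markerˣ ≢ marker₁ × Reaches (opposite q) ℓ ⊎ markerˣ ≢ marker₂ × Reaches q ℓ → ℓ ∈ S
      back (inj₁ (_ , r)) = proj₁ (from (to (Perfect⇔ _) p̄ ℓ) r)
      back (inj₂ (_ , r)) = proj₁ (from (to (Perfect⇔ _) p ℓ) r)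

  -- The states orient the edge: `opposite q` is the empty extremity, so its new opposite `marker₂`
  -- is the centre.
  starNode : UniqueEdge T (λ r → Perfect T G S r × EmptyState T S (opposite r)) q →
    IsSplitTree (subdivide T q (star marker₂)) (addVertex G S)
  starNode ((p , ē) , unique) =
    isGLT⁺ , isReduced⁺ reduced (inj₂ (marker₂ , centre)) (λ c → ⊥-elim (¬clique c)) ¬star₁ ¬star₂
    , Accessibility.isAccessibilityGraph⁺ (inj₂ (refl , λ ())) G acc S⇔
    where
    open Subdivision glt q (star marker₂)

    centre : IsStarCentre (star marker₂) marker₂
    centre = s≤s (s≤s (s≤s z≤n)) , (λ i≢c → inj₁ (refl , i≢c))
           , λ { (inj₁ (i≡c , _)) → inj₁ i≡c ; (inj₂ (j≡c , _)) → inj₂ j≡c }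

    ¬ˣ∼₁ : ¬ Adj (star marker₂) markerˣ marker₁
    ¬ˣ∼₁ (inj₁ (() , _))
    ¬ˣ∼₁ (inj₂ (() , _))

    ¬clique : ¬ IsClique (star marker₂)
    ¬clique c = ¬ˣ∼₁ (c λ ())

    ¬centre₁ : ¬ IsStarCentre (star marker₂) marker₁
    ¬centre₁ (_ , spoke , _) = ¬ˣ∼₁ (adj-sym (star marker₂) {marker₁} {markerˣ} (spoke λ ()))

    ¬star₁ : ∀ {u i} → q ≡ marker u i → ¬ StarJoinable (star marker₂) marker₁ (label u) i
    ¬star₁ refl (_ , _ , inj₁ (c , _)) = ¬centre₁ c
    -- `marker₁` is a leg of the new star, so a join needs `i` to be the centre of `u`, and the edge
    -- of any other `j` then shows the states of `q`, with the perfect extremity on the far side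
    -- from `u`.
    ¬star₁ {u} {i} refl (_ , _ , inj₂ (_ , c)) with another (degree≥3 u) i
    ... | j , i≢j with centre-spreads c p ē i≢j
    ...   | p′ , e′ = distinct-markers i≢j (SameEdge-oppositeʳ
      (unique (opposite (marker u j))
        (p′ , subst (EmptyState T S) (sym (opposite-involutive (marker u j))) e′)))

    ¬star₂ : ∀ {u i} → opposite q ≡ marker u i → ¬ StarJoinable (star marker₂) marker₂ (label u) i
    ¬star₂ _ (_ , _ , inj₂ (¬c , _)) = ¬c centre
    -- `marker₂` is the centre of the new star, so a join needs `i` to be a leg of `u`. The second
    -- edge with the states of `q` is then the one at the centre `c` of `u`.
    ¬star₂ {u} {i} eq (_ , (c , star-c) , inj₁ (_ , ¬i-centre)) =
      distinct-markers i≢c (subst (λ r → SameEdge T r (marker u c)) eq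
        (SameEdge-oppositeˡ (unique (marker u c)
          (leg-spreads star-c i≢c
            (subst (Perfect T G S) (trans (sym (opposite-involutive q)) (cong opposite eq)) p)
            (subst (EmptyState T S) eq ē)))))
      where
      i≢c : i ≢ c
      i≢c refl = ¬i-centre star-c

    S⇔ : ∀ ℓ → ℓ ∈ S ⇔ (Adj (star marker₂) markerˣ marker₁ × Reaches (opposite q) ℓ
                       ⊎ Adj (star marker₂) markerˣ marker₂ × Reaches q ℓ)
    S⇔ ℓ = mk⇔ there [ ⊥-elim ∘ ¬ˣ∼₁ ∘ proj₁ , (λ { (_ , r) → proj₁ (from (to (Perfect⇔ _) p ℓ) r) }) ]′
      where
      there : ℓ ∈ S → Adj (star marker₂) markerˣ marker₁ × Reaches (opposite q) ℓ
                    ⊎ Adj (star marker₂) markerˣ marker₂ × Reaches q ℓ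
      there s with Beyond-cover q ℓ
      ... | inj₁ b = inj₂ (inj₂ (refl , λ ()) , to (to (Perfect⇔ _) p ℓ) (s , b))
      -- All of `S` lies beyond `q`, so `x` has to reach only that side.
      ... | inj₂ b = ⊥-elim (to (Empty⇔ _) ē ℓ b s)

proposition4p17 : ∀ {n : ℕ} (G : Graph n) (S : Subset n) (T : RawGLT n) →
    Connected G →
    Connected (addVertex G S) →
    IsSplitTree T G →
    let open RawGLT T using (opposite) in
    (∀ q →
    UniqueEdge T (λ r → Perfect T G S r × Perfect T G S (opposite r)) q →
    IsSplitTree (subdivide T q (complete 3)) (addVertex G S))
    ×
    (∀ q →
    UniqueEdge T (λ r → Perfect T G S r × EmptyState T S (opposite r)) q →
    IsSplitTree (subdivide T q (star marker₂)) (addVertex G S))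
proposition4p17 G S T _ _ st = NewNode.cliqueNode st , NewNode.starNode st
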